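{- Let $G$ be a graph and let $M$ be a minimum maximal matching of $G$. If $M$ admits a dominating transversal, then $\gamma(G) \le |M| = \gamma_e(G)$.
   Context: Graphs are finite, simple and undirected. The domination number $\gamma(G)$ is the minimum size of a set $S$ of vertices such that every vertex outside $S$ has a neighbour in $S$. A matching is a set of edges no two of which share a vertex; it is maximal if no edge of $G$ can be added to it. The edge domination number $\gamma_e(G)$ is the minimum size of a maximal matching of $G$, and a minimum maximal matching is a maximal matching of that size. For a matching $M$, $V(M)$ is the set of vertices lying on edges of $M$; the other vertices are unsaturated by $M$. A transversal of $M$ is a set $T \subseteq V(M)$ containing exactly one endpoint of each edge of $M$. A transversal $T$ is dominating if every vertex of $G$ unsaturated by $M$ has a neighbour in $T$. -}

module Defs where

open import Data.Empty using (⊥-elim)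
open import Data.Fin using (Fin; _<_)
open import Data.Fin.Properties using (_≟_; _<?_; any?; all?)
open import Data.Fin.Subset using (Subset; _∈_; _∉_; _∪_; _⊃_; ⁅_⁆; ∣_∣; ⊥; ⊤)
open import Data.Fin.Subset.Induction using (⊃-wellFounded)
open import Data.Fin.Subset.Properties
  using (_∈?_; ∈⊤; ∉⊥; anySubset?; p⊆p∪q; q⊆p∪q; x∈⁅x⁆)
open import Data.List using (List; allFin; cartesianProduct; filter; length; lookup)
open import Data.Nat as ℕ using (ℕ; _≤_)
open import Data.Nat.Induction using (<-wellFounded)
open import Data.Nat.Properties using (≮⇒≥)
open import Data.Product using (_×_; _,_; ∃; ∃!; proj₁; proj₂)
open import Data.Sum using (_⊎_)
open import Induction.WellFounded using (Acc; acc)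
open import Level using (0ℓ)
open import Relation.Binary using (Rel; Symmetric; Irreflexive) renaming (Decidable to Decidable₂)
open import Relation.Binary.PropositionalEquality using (_≡_; _≢_; refl)
open import Relation.Nullary using (¬_; yes; no; ¬?; _×-dec_; _⊎-dec_; _→-dec_)
open import Relation.Unary using (Pred; Decidable)

module _ {n : ℕ} (P : Pred (Subset n) 0ℓ) where

  IsMinimumSize : ℕ → Set
  IsMinimumSize k = (∃ λ S → P S × ∣ S ∣ ≡ k) × (∀ S → P S → k ≤ ∣ S ∣)

  minimumSize : Decidable P → ∃ P → ∃ IsMinimumSize
  minimumSize P? (S₀ , pS₀) = descend S₀ pS₀ (<-wellFounded ∣ S₀ ∣)
    where
    descend : ∀ S → P S → Acc ℕ._<_ ∣ S ∣ → ∃ IsMinimumSize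
    descend S pS (acc rec) with anySubset? (λ T → P? T ×-dec (∣ T ∣ ℕ.<? ∣ S ∣))
    ... | yes (T , pT , T<S) = descend T pT (rec T<S)
    ... | no  none           =
      ∣ S ∣ , (S , pS , refl) , λ T pT → ≮⇒≥ λ T<S → none (T , pT , T<S)

record Graph (n : ℕ) : Set₁ where
  field
    Adj    : Rel (Fin n) 0ℓ
    Adj?   : Decidable₂ Adj
    sym    : Symmetric Adj
    irrefl : Irreflexive _≡_ Adj

module _ {n : ℕ} (G : Graph n) where
  open Graph G

  Dominating : Pred (Subset n) 0ℓ
  Dominating S = ∀ v → v ∉ S → ∃ λ u → u ∈ S × Adj v u

  dominating? : Decidable Dominating
  dominating? S =
    all? λ v → ¬? (v ∈? S) →-dec any? λ u → (u ∈? S) ×-dec Adj? v u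

  ⊤-dominating : Dominating ⊤
  ⊤-dominating v v∉⊤ = ⊥-elim (v∉⊤ ∈⊤)

  γ : ℕ
  γ = proj₁ (minimumSize Dominating dominating? (⊤ , ⊤-dominating))

  -- Each undirected edge {u , v} is listed exactly once, as (u , v) with u < v.
  edges : List (Fin n × Fin n)
  edges = filter (λ (u , v) → (u <? v) ×-dec Adj? u v)
                 (cartesianProduct (allFin n) (allFin n))

  -- Edges are positions in the duplicate-free list above, so that a set of
  -- edges is a Subset and its number of edges is ∣_∣.
  Edge : Set
  Edge = Fin (length edges)

  EdgeSet : Set
  EdgeSet = Subset (length edges)

  Incident : Fin n → Edge → Set
  Incident v e = v ≡ proj₁ (lookup edges e) ⊎ v ≡ proj₂ (lookup edges e)

  incident? : Decidable₂ Incident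
  incident? v e = (v ≟ _) ⊎-dec (v ≟ _)

  Matching : Pred EdgeSet 0ℓ
  Matching M = ∀ e f → e ∈ M → f ∈ M → e ≢ f →
               ¬ (∃ λ v → Incident v e × Incident v f)

  matching? : Decidable Matching
  matching? M = all? λ e → all? λ f →
    (e ∈? M) →-dec (f ∈? M) →-dec ¬? (e ≟ f) →-dec
    ¬? (any? λ v → incident? v e ×-dec incident? v f)

  MaximalMatching : Pred EdgeSet 0ℓ
  MaximalMatching M = Matching M × (∀ e → e ∉ M → ¬ Matching (M ∪ ⁅ e ⁆))

  maximalMatching? : Decidable MaximalMatching
  maximalMatching? M =
    matching? M ×-dec all? λ e → ¬? (e ∈? M) →-dec ¬? (matching? (M ∪ ⁅ e ⁆))

  maximalMatching : ∃ MaximalMatching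
  maximalMatching = extend ⊥ (λ e f e∈⊥ → ⊥-elim (∉⊥ e∈⊥)) (⊃-wellFounded ⊥)
    where
    extend : ∀ M → Matching M → Acc _⊃_ M → ∃ MaximalMatching
    extend M mM (acc rec) with any? (λ e → ¬? (e ∈? M) ×-dec matching? (M ∪ ⁅ e ⁆))
    ... | yes (e , e∉M , m) = extend (M ∪ ⁅ e ⁆) m
            (rec (p⊆p∪q ⁅ e ⁆ , e , q⊆p∪q M ⁅ e ⁆ (x∈⁅x⁆ e) , e∉M))
    ... | no  none          = M , mM , λ e e∉M m → none (e , e∉M , m)

  γₑ : ℕ
  γₑ = proj₁ (minimumSize MaximalMatching maximalMatching? maximalMatching)

  MinimumMaximalMatching : Pred EdgeSet 0ℓ
  MinimumMaximalMatching M = MaximalMatching M × ∣ M ∣ ≡ γₑ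

  -- Saturated M v says that v ∈ V(M).
  Saturated : EdgeSet → Fin n → Set
  Saturated M v = ∃ λ e → e ∈ M × Incident v e

  Transversal : EdgeSet → Pred (Subset n) 0ℓ
  Transversal M T = (∀ v → v ∈ T → Saturated M v)
                  × (∀ e → e ∈ M → ∃! _≡_ λ v → Incident v e × v ∈ T)

  DominatingTransversal : EdgeSet → Pred (Subset n) 0ℓ
  DominatingTransversal M T =
    Transversal M T × (∀ v → ¬ Saturated M v → ∃ λ u → u ∈ T × Adj v u)

{-# OPTIONS --safe #-}
module Submission where

open import Defs
open import Data.Bool using (true; false)
open import Data.Empty using (⊥-elim)
open import Data.Fin using (Fin; suc; _<?_)
open import Data.Fin.Properties using (any?; suc-injective; 0≢1+n)
open import Data.Fin.Subset using (Subset; _∈_; ∣_∣; ⁅_⁆; _-_)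
open import Data.Fin.Subset.Properties
  using (_∈?_; x∈p⇒∣p-x∣<∣p∣; x∈p∧x≢y⇒x∈p-y; p─q⊆p)
open import Data.List using (allFin; cartesianProduct; lookup)
open import Data.List.Membership.Propositional.Properties using (∈-filter⁻; ∈-lookup)
open import Data.Nat using (ℕ; _≤_; z≤n)
open import Data.Nat.Properties using (≤-trans; ≤-<-trans)
open import Data.Product using (_×_; _,_; ∃; proj₁; proj₂)
open import Data.Sum using (inj₁; inj₂)
open import Data.Vec using ([]; _∷_; here; there)
open import Relation.Binary.PropositionalEquality using (_≡_; refl; subst)
open import Relation.Nullary using (yes; no; _×-dec_)

-- A dominating transversal `T` of `M` dominates all of `G`: unsaturated vertices have neighbours in
-- `T` by hypothesis, and a saturated vertex outside `T` is adjacent to the other endpoint of its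
-- matching edge, which must be the one in `T`. Since each edge of `M` holds just one vertex of `T`,
-- also `∣ T ∣ ≤ ∣ M ∣`, whence the bound on `γ G`. That count rests on the pigeonhole lemma below,
-- stated for a relation so that `Incident` can be used directly.

injectiveRelation⇒∣p∣≤∣q∣ : ∀ {m n} {p : Subset m} {q : Subset n}
  (R : Fin m → Fin n → Set) →
  (∀ {x} → x ∈ p → ∃ λ y → y ∈ q × R x y) →
  (∀ {x x′ y} → x ∈ p → x′ ∈ p → y ∈ q → R x y → R x′ y → x ≡ x′) →
  ∣ p ∣ ≤ ∣ q ∣
injectiveRelation⇒∣p∣≤∣q∣ {p = []} R total inj = z≤n
injectiveRelation⇒∣p∣≤∣q∣ {p = false ∷ p} R total inj =
  injectiveRelation⇒∣p∣≤∣q∣ (λ x → R (suc x)) (λ x∈p → total (there x∈p))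
    λ x∈p x′∈p y∈q r r′ → suc-injective (inj (there x∈p) (there x′∈p) y∈q r r′)
-- Reserve the partner `y₀` of the head and delete it from `q`. By injectivity no later element of
-- `p` is related to `y₀`, so the tail still has partners in `q - y₀`, which is strictly smaller
-- than `q`.
injectiveRelation⇒∣p∣≤∣q∣ {p = true ∷ p} {q} R total inj with total here
... | y₀ , y₀∈q , r₀ = ≤-<-trans ∣p∣≤∣q-y₀∣ (x∈p⇒∣p-x∣<∣p∣ y₀∈q)
  where
  total′ : ∀ {x} → x ∈ p → ∃ λ y → y ∈ q - y₀ × R (suc x) y
  total′ x∈p with total (there x∈p)
  ... | y , y∈q , r = y , x∈p∧x≢y⇒x∈p-y y∈q y≢y₀ , r
    where
    y≢y₀ = λ y≡y₀ →
      0≢1+n (inj here (there x∈p) y₀∈q r₀ (subst (R _) y≡y₀ r))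

  ∣p∣≤∣q-y₀∣ : ∣ p ∣ ≤ ∣ q - y₀ ∣
  ∣p∣≤∣q-y₀∣ = injectiveRelation⇒∣p∣≤∣q∣ (λ x → R (suc x)) total′
    λ x∈p x′∈p y∈q-y₀ r r′ →
      suc-injective (inj (there x∈p) (there x′∈p) (p─q⊆p q ⁅ y₀ ⁆ y∈q-y₀) r r′)

module _ {n : ℕ} (G : Graph n) where
  open Graph G

  endpoints-adjacent : ∀ e → Adj (proj₁ (lookup (edges G) e)) (proj₂ (lookup (edges G) e))
  endpoints-adjacent e = proj₂ (proj₂ (∈-filter⁻
    (λ (u , v) → (u <? v) ×-dec Adj? u v)
    {xs = cartesianProduct (allFin n) (allFin n)} (∈-lookup {xs = edges G} e)))

  γ≤∣dominating∣ : ∀ {S} → Dominating G S → γ G ≤ ∣ S ∣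
  -- The `_` is the initial dominating set fixed in the definition of `γ`, recovered by unification.
  γ≤∣dominating∣ {S} = proj₂ (proj₂ (minimumSize (Dominating G) (dominating? G) _)) S

  module _ {M : EdgeSet G} {T : Subset n} where

    transversal⇒∣T∣≤∣M∣ : Transversal G M T → ∣ T ∣ ≤ ∣ M ∣
    transversal⇒∣T∣≤∣M∣ (T⊆V[M] , unique) =
      injectiveRelation⇒∣p∣≤∣q∣ (Incident G) (T⊆V[M] _) injective
      where
      injective : ∀ {v w e} → v ∈ T → w ∈ T → e ∈ M →
                  Incident G v e → Incident G w e → v ≡ w
      injective {e = e} v∈T w∈T e∈M v∼e w∼e with unique e e∈M
      ... | u , _ , u≡ with refl ← u≡ (v∼e , v∈T) = u≡ (w∼e , w∈T)

    dominatingTransversal⇒dominating : DominatingTransversal G M T → Dominating G T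
    dominatingTransversal⇒dominating ((_ , unique) , dominates) v v∉T
      with any? (λ e → (e ∈? M) ×-dec incident? G v e)
    ... | no unsaturated = dominates v unsaturated
    ... | yes (e , e∈M , v∼e) with unique e e∈M
    ...   | u , (u∼e , u∈T) , _ = u , u∈T , adjacent v∼e u∼e
      where
      adjacent : Incident G v e → Incident G u e → Adj v u
      -- If `v` and `u` are the same end of `e`, then `v` lies in `T`, a contradiction; otherwise
      -- they are its two ends.
      adjacent (inj₁ refl) (inj₁ refl) = ⊥-elim (v∉T u∈T)
      adjacent (inj₁ refl) (inj₂ refl) = endpoints-adjacent e
      adjacent (inj₂ refl) (inj₁ refl) = sym (endpoints-adjacent e)
      adjacent (inj₂ refl) (inj₂ refl) = ⊥-elim (v∉T u∈T)

proposition1 : (n : ℕ) (G : Graph n) (M : EdgeSet G) →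
    MinimumMaximalMatching G M → ∃ (DominatingTransversal G M) →
    γ G ≤ ∣ M ∣ × ∣ M ∣ ≡ γₑ G
proposition1 n G M (_ , ∣M∣≡γₑ) (T , domT) =
  ≤-trans (γ≤∣dominating∣ G (dominatingTransversal⇒dominating G domT))
          (transversal⇒∣T∣≤∣M∣ G (proj₁ domT))
  , ∣M∣≡γₑ
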